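{- Let $M$ be a simple matroid, let $k\ge 1$, and let $(X_1,\dots,X_k)\in\mathcal{F}l^k_M$. Then $$\mathrm{sgn}\bigl(\mu^k(X_1,\dots,X_k)\bigr)=\prod_{i=1}^k(-1)^{\mathrm{rk}(X_i)}.$$
   Context: A matroid $M=(\mathcal{A},\mathrm{rk})$ is given by a finite ground set $\mathcal{A}$ and its rank function; it is simple if it has no loops and no parallel elements. $L(M)$ is its lattice of flats, and for $S\subseteq\mathcal{A}$, $\vee S$ denotes the smallest flat containing $S$ (the closure of $S$). For $k\ge1$ let $\mathcal{F}l^k_M=\{(X_1,\dots,X_k)\in L(M)^k\mid X_1\subseteq X_2\subseteq\cdots\subseteq X_k\}$ and $\mathcal{C}^k_{\mathcal{A}}=\{(A_1,\dots,A_k)\in(2^{\mathcal{A}})^k\mid A_1\subseteq\cdots\subseteq A_k\subseteq\mathcal{A}\}$ (inclusions need not be strict). The $k$th chain Möbius function $\mu^k:\mathcal{F}l^k_M\to\mathbb{Z}$ is $$\mu^k(X_1,\dots,X_k)=\sum_{\substack{(A_i)\in\mathcal{C}^k_{\mathcal{A}}\\ \vee A_i=X_i\ \text{for all } i}}\ \prod_{i=1}^k(-1)^{|A_i|}.$$ Here $\mathrm{sgn}(m)\in\{ -1,0,1\}$ is the sign of the integer $m$. -}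

module Defs where

open import Data.Fin using (Fin)
open import Data.Fin.Properties using (all?)
open import Data.Fin.Subset
  using (Subset; inside; outside; _∈_; _∉_; _⊆_; _∩_; _∪_; ⁅_⁆; ∣_∣)
open import Data.Fin.Subset.Properties using (_∈?_; _⊆?_; anySubset?)
open import Data.Integer as ℤ using (ℤ; +_; -[1+_]; 0ℤ; 1ℤ; -1ℤ)
open import Data.List as List using (List; []; _∷_)
open import Data.Nat as ℕ using (ℕ; zero; suc; _≤_; _<_; _<?_)
open import Data.Product using (_×_; _,_)
open import Data.Vec as Vec using (Vec; []; _∷_)
import Data.Vec.Relation.Binary.Pointwise.Inductive as Pointwise
open import Data.Vec.Relation.Unary.All using (All)
open import Data.Vec.Relation.Unary.Linked using (Linked; linked?)
open import Relation.Binary using (Decidable)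
open import Relation.Binary.PropositionalEquality using (_≡_; _≢_)
open import Relation.Nullary using (¬_)
open import Relation.Nullary.Decidable
  using (¬?; _→-dec_; _×-dec_; map′; decidable-stable)
import Relation.Unary as U

-- A matroid on the ground set Fin n, axiomatised by its rank function.
record Matroid (n : ℕ) : Set where
  field
    rk            : Subset n → ℕ
    rk-bounded    : ∀ A → rk A ≤ ∣ A ∣
    rk-monotone   : ∀ A B → A ⊆ B → rk A ≤ rk B
    rk-submodular : ∀ A B → rk (A ∪ B) ℕ.+ rk (A ∩ B) ≤ rk A ℕ.+ rk B

open Matroid public using (rk)

module _ {n : ℕ} (M : Matroid n) where

  Loop : Fin n → Set
  Loop e = rk M ⁅ e ⁆ ≡ 0

  Parallel : Fin n → Fin n → Set
  Parallel e f =
    e ≢ f × ¬ Loop e × ¬ Loop f × rk M (⁅ e ⁆ ∪ ⁅ f ⁆) ≡ 1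

  Simple : Set
  Simple = (∀ e → ¬ Loop e) × (∀ e f → ¬ Parallel e f)

  Flat : Subset n → Set
  Flat F = ∀ e → e ∉ F → rk M F < rk M (F ∪ ⁅ e ⁆)

  flat? : U.Decidable Flat
  flat? F = all? λ e → ¬? (e ∈? F) →-dec (rk M F <? rk M (F ∪ ⁅ e ⁆))

  -- IsClosure S X expresses ⋁ S = X: X is the smallest flat containing S.
  record IsClosure (S X : Subset n) : Set where
    field
      flat     : Flat X
      contains : S ⊆ X
      smallest : ∀ G → Flat G → S ⊆ G → X ⊆ G

  isClosure? : Decidable IsClosure
  isClosure? S X = map′
    (λ (f , c , ¬bad) → record
      { flat     = f
      ; contains = λ {e} → c {e}
      ; smallest = λ G flatG S⊆G → decidable-stable (X ⊆? G) λ X⊈G →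
          ¬bad (G , flatG , (λ {e} → S⊆G {e}) , X⊈G) })
    (λ cl → let open IsClosure cl in
      flat , (λ {e} → contains {e}) , λ (G , flatG , S⊆G , X⊈G) →
        X⊈G (smallest G flatG (λ {e} → S⊆G {e})))
    (flat? X ×-dec (S ⊆? X) ×-dec
      ¬? (anySubset? λ G → flat? G ×-dec (S ⊆? G) ×-dec ¬? (X ⊆? G)))

  record FlatChain (k : ℕ) : Set where
    field
      flats   : Vec (Subset n) k
      areFlat : All Flat flats
      nested  : Linked _⊆_ flats

  open FlatChain public using (flats)

-- All vectors of length k over xs, each listed once if xs has no repetitions.
tuples : ∀ {A : Set} → List A → (k : ℕ) → List (Vec A k)
tuples xs zero    = [] ∷ []
tuples xs (suc k) = List.cartesianProductWith _∷_ xs (tuples xs k)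

-- A Subset n is a Vec Side n, so this enumerates the power set of Fin n.
subsets : (n : ℕ) → List (Subset n)
subsets n = tuples (inside ∷ outside ∷ []) n

chains : (n k : ℕ) → List (Vec (Subset n) k)
chains n k = List.filter (linked? _⊆?_) (tuples (subsets n) k)

sumℤ : List ℤ → ℤ
sumℤ = List.foldr ℤ._+_ 0ℤ

∏[_] : ∀ {A : Set} {k} → (A → ℤ) → Vec A k → ℤ
∏[ f ] xs = Vec.foldr′ ℤ._*_ 1ℤ (Vec.map f xs)

μ : ∀ {n k} (M : Matroid n) → FlatChain M k → ℤ
μ {n} {k} M X =
  sumℤ (List.map ∏[ (λ A → -1ℤ ℤ.^ ∣ A ∣) ]
    (List.filter (λ As → Pointwise.decidable (isClosure? M) As (flats X))
      (chains n k)))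

-- Unlike the library's ℤ.sign, this sends 0 to 0.
sgn : ℤ → ℤ
sgn (+ zero)  = 0ℤ
sgn (+ suc _) = 1ℤ
sgn -[1+ _ ]  = -1ℤ

{-# OPTIONS --safe #-}

-- The sums are evaluated from the last set of the chain backwards. Given A ⊆ X, the sum of
-- (-1)^|S| over A ⊆ S with closure X vanishes unless A is flat: an element of X spanned by A can be
-- toggled freely. Hence the last set forces A_{k-1} = X_{k-1}, after which the factor it contributes
-- is a constant independent of A_{k-2}, and the pattern repeats: sums over tails of even length do not
-- depend on the preceding set, those over tails of odd length are supported on flats. The sign
-- for a flat A follows by deletion-contraction on an interval L ⊆ S ⊆ U, where both parts have the
-- same sign, and the contraction or the deletion is nonzero according as e is a coloop of U or not.
module Submission where

open import Defs
open import Data.Bool using (if_then_else_)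
open import Data.Empty using (⊥-elim)
open import Data.Fin using (Fin; zero; suc)
open import Data.Fin.Properties using (any?)
open import Data.Fin.Subset using (Subset; inside; outside; _∈_; _∉_; _⊆_; _∩_; _∪_; ⁅_⁆; ∣_∣; _-_; ⊥)
open import Data.Fin.Subset.Properties
open import Data.Integer using (ℤ; +_; 0ℤ; 1ℤ; -1ℤ; _^_; +<+; +≤+)
open import Data.Integer.Tactic.RingSolver using (solve-∀)
open import Data.List as List using (List; []; _∷_; _++_)
open import Data.Nat using (ℕ; zero; suc; _≤_; _<_; _≟_; _<?_; z≤n; s≤s)
open import Data.Product using (∃; _×_; _,_; proj₁; proj₂)
open import Data.Sum using (_⊎_; inj₁; inj₂; [_,_]′)
open import Data.Vec as Vec using (Vec; []; _∷_; here; there)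
open import Data.Vec.Relation.Binary.Pointwise.Inductive as Pointwise using (Pointwise; []; _∷_)
open import Data.Vec.Relation.Unary.All using (All; []; _∷_)
open import Data.Vec.Relation.Unary.Linked using (Linked; []; [-]; _∷_; linked?)
open import Function using (_∘_)
open import Relation.Binary.PropositionalEquality using (_≡_; _≢_; refl; sym; trans; cong; cong₂; subst; module ≡-Reasoning)
open import Relation.Nullary using (¬_; Dec; yes; no; does)
open import Relation.Nullary.Decidable using (¬?; _×-dec_; decidable-stable)
open import Relation.Unary using (Decidable)
import Data.Integer as ℤ
import Data.Integer.Properties as ℤₚ
import Data.Nat as ℕ
import Data.Nat.Properties as ℕₚ

private
  variable
    A B : Set
    P Q R : Set
    n k : ℕ

-- Finite sums over lists, tuples and power sets.

∑ : List A → (A → ℤ) → ℤ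
∑ xs f = sumℤ (List.map f xs)

∑-cong : ∀ (xs : List A) {f g} → (∀ x → f x ≡ g x) → ∑ xs f ≡ ∑ xs g
∑-cong []       eq = refl
∑-cong (x ∷ xs) eq = cong₂ ℤ._+_ (eq x) (∑-cong xs eq)

∑-zero : ∀ (xs : List A) {f} → (∀ x → f x ≡ 0ℤ) → ∑ xs f ≡ 0ℤ
∑-zero []       eq = refl
∑-zero (x ∷ xs) eq = cong₂ ℤ._+_ (eq x) (∑-zero xs eq)

∑-+ : ∀ (xs : List A) f g → ∑ xs (λ x → f x ℤ.+ g x) ≡ ∑ xs f ℤ.+ ∑ xs g
∑-+ []       f g = refl
∑-+ (x ∷ xs) f g = trans (cong (λ z → f x ℤ.+ g x ℤ.+ z) (∑-+ xs f g)) (interchange (f x) (g x) _ _)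
  where
  interchange : ∀ a b c d → a ℤ.+ b ℤ.+ (c ℤ.+ d) ≡ a ℤ.+ c ℤ.+ (b ℤ.+ d)
  interchange = solve-∀

∑-*ˡ : ∀ (xs : List A) c f → ∑ xs (λ x → c ℤ.* f x) ≡ c ℤ.* ∑ xs f
∑-*ˡ []       c f = sym (ℤₚ.*-zeroʳ c)
∑-*ˡ (x ∷ xs) c f = trans (cong (ℤ._+_ (c ℤ.* f x)) (∑-*ˡ xs c f)) (sym (ℤₚ.*-distribˡ-+ c (f x) _))

∑-++ : ∀ (xs ys : List A) f → ∑ (xs ++ ys) f ≡ ∑ xs f ℤ.+ ∑ ys f
∑-++ []       ys f = sym (ℤₚ.+-identityˡ _)
∑-++ (x ∷ xs) ys f = trans (cong (ℤ._+_ (f x)) (∑-++ xs ys f)) (sym (ℤₚ.+-assoc (f x) _ _))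

∑-map : ∀ (g : A → B) xs f → ∑ (List.map g xs) f ≡ ∑ xs (f ∘ g)
∑-map g []       f = refl
∑-map g (x ∷ xs) f = cong (ℤ._+_ (f (g x))) (∑-map g xs f)

∑-tuples-suc : ∀ (xs : List A) k (f : Vec A (suc k) → ℤ) →
  ∑ (tuples xs (suc k)) f ≡ ∑ xs λ x → ∑ (tuples xs k) λ v → f (x ∷ v)
∑-tuples-suc xs k f = go xs
  where
  go : ∀ ys → ∑ (List.cartesianProductWith _∷_ ys (tuples xs k)) f ≡ ∑ ys λ y → ∑ (tuples xs k) λ v → f (y ∷ v)
  go []       = refl
  go (y ∷ ys) = trans (∑-++ (List.map (y ∷_) (tuples xs k)) _ f)
    (cong₂ ℤ._+_ (∑-map (y ∷_) (tuples xs k) f) (go ys))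

∑-subsets-suc : ∀ n (f : Subset (suc n) → ℤ) →
  ∑ (subsets (suc n)) f ≡ ∑ (subsets n) (f ∘ (inside ∷_)) ℤ.+ ∑ (subsets n) (f ∘ (outside ∷_))
∑-subsets-suc n f = trans (∑-tuples-suc (inside ∷ outside ∷ []) n f)
  (cong (ℤ._+_ (∑ (subsets n) (f ∘ (inside ∷_)))) (ℤₚ.+-identityʳ _))

-- Toggling `e` is a fixed-point-free involution on the power set, so the sum splits into pairs that
-- add up to zero. The recursion moves to the coordinate `e`, where the two halves of the power set
-- are exactly the two sides of the pairing.
∑-cancel : (e : Fin n) (f : Subset n → ℤ) →
  (∀ S → e ∉ S → f S ℤ.+ f (S ∪ ⁅ e ⁆) ≡ 0ℤ) → ∑ (subsets n) f ≡ 0ℤ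
∑-cancel {suc n} zero f opposite = trans (∑-subsets-suc n f)
  (trans (sym (∑-+ (subsets n) _ _)) (∑-zero (subsets n) λ S →
    trans (ℤₚ.+-comm (f (inside ∷ S)) _)
      (subst (λ T → f (outside ∷ S) ℤ.+ f (inside ∷ T) ≡ 0ℤ) (∪-identityʳ S) (opposite (outside ∷ S) λ ()))))
∑-cancel {suc n} (suc e) f opposite = trans (∑-subsets-suc n f)
  (cong₂ ℤ._+_
    (∑-cancel e _ λ S e∉S → opposite (inside ∷ S) (e∉S ∘ drop-there))
    (∑-cancel e _ λ S e∉S → opposite (outside ∷ S) (e∉S ∘ drop-there)))

∑-single : ∀ (S : Subset n) f → (∀ T → T ≢ S → f T ≡ 0ℤ) → ∑ (subsets n) f ≡ f S
∑-single []                f vanish = ℤₚ.+-identityʳ _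
∑-single {suc n} (inside ∷ S) f vanish = trans (∑-subsets-suc n f)
  (trans (cong₂ ℤ._+_ (∑-single S _ λ T T≢S → vanish _ λ { refl → T≢S refl })
                      (∑-zero (subsets n) λ T → vanish _ λ ()))
         (ℤₚ.+-identityʳ _))
∑-single {suc n} (outside ∷ S) f vanish = trans (∑-subsets-suc n f)
  (trans (cong₂ ℤ._+_ (∑-zero (subsets n) λ T → vanish _ λ ())
                      (∑-single S _ λ T T≢S → vanish _ λ { refl → T≢S refl }))
         (ℤₚ.+-identityˡ _))

-- Summands guarded by decidable conditions.

when : Dec P → ℤ → ℤ
when p? x = if does p? then x else 0ℤ

when-yes : (p? : Dec P) → P → ∀ {x} → when p? x ≡ x
when-yes (yes _) p = refl
when-yes (no ¬p) p = ⊥-elim (¬p p)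

when-zero : (p? : Dec P) → ∀ {x} → (P → x ≡ 0ℤ) → when p? x ≡ 0ℤ
when-zero (yes p) eq = eq p
when-zero (no _)  eq = refl

when-cong : (p? : Dec P) (q? : Dec Q) → (P → Q) → (Q → P) → ∀ {x y} → (P → x ≡ y) →
  when p? x ≡ when q? y
when-cong (yes p) q? to from eq = trans (eq p) (sym (when-yes q? (to p)))
when-cong (no ¬p) q? to from eq = sym (when-zero q? λ q → ⊥-elim (¬p (from q)))

when-cancel : (p? : Dec P) → ∀ {x y} → (P → x ℤ.+ y ≡ 0ℤ) → when p? x ℤ.+ when p? y ≡ 0ℤ
when-cancel (yes p) eq = eq p
when-cancel (no _)  eq = refl

*-when : (p? : Dec P) → ∀ c x → c ℤ.* when p? x ≡ when p? (c ℤ.* x)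
*-when (yes _) c x = refl
*-when (no _)  c x = ℤₚ.*-zeroʳ c

-- Placing `c` between the two guards prepares for pulling it out of a sum. This serves both to peel
-- the first set off a chain and to trade a closure condition for containment plus a rank condition.
when-nested : (r? : Dec R) (p? : Dec P) (q? : Dec Q) → (R → P × Q) → (P → Q → R) → ∀ c x →
  when r? (c ℤ.* x) ≡ when p? (c ℤ.* when q? x)
when-nested r? (no ¬p) q?      to from c x = when-zero r? λ r → ⊥-elim (¬p (proj₁ (to r)))
when-nested r? (yes p) (yes q) to from c x = when-yes r? (from p q)
when-nested r? (yes p) (no ¬q) to from c x =
  trans (when-zero r? λ r → ⊥-elim (¬q (proj₂ (to r)))) (sym (ℤₚ.*-zeroʳ c))

∑-filter : ∀ {P : A → Set} (P? : Decidable P) xs f →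
  ∑ (List.filter P? xs) f ≡ ∑ xs λ x → when (P? x) (f x)
∑-filter P? []       f = refl
∑-filter P? (x ∷ xs) f with P? x
... | yes _ = cong (ℤ._+_ (f x)) (∑-filter P? xs f)
... | no _  = trans (∑-filter P? xs f) (sym (ℤₚ.+-identityˡ _))

∑-when : (p? : Dec P) (xs : List A) (f : A → ℤ) → ∑ xs (λ x → when p? (f x)) ≡ when p? (∑ xs f)
∑-when (yes _) xs f = refl
∑-when (no _)  xs f = ∑-zero xs λ _ → refl

-- Powers of -1 and signs.

ε : ℕ → ℤ
ε m = -1ℤ ^ m

ε-+ : ∀ m n → ε (m ℕ.+ n) ≡ ε m ℤ.* ε n
ε-+ = ℤₚ.^-distribˡ-+-* -1ℤ

ε-suc-suc : ∀ m → ε (suc (suc m)) ≡ ε m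
ε-suc-suc m = trans (sym (ℤₚ.*-assoc -1ℤ -1ℤ (ε m))) (ℤₚ.*-identityˡ (ε m))

ε-square : ∀ m → ε m ℤ.* ε m ≡ 1ℤ
ε-square zero    = refl
ε-square (suc m) = trans (negate² (ε m)) (ε-square m)
  where
  negate² : ∀ x → -1ℤ ℤ.* x ℤ.* (-1ℤ ℤ.* x) ≡ x ℤ.* x
  negate² = solve-∀

ε-suc-cancel : ∀ m → ε m ℤ.+ ε (suc m) ≡ 0ℤ
ε-suc-cancel m = identity (ε m)
  where
  identity : ∀ x → x ℤ.+ -1ℤ ℤ.* x ≡ 0ℤ
  identity = solve-∀

-- Says that `z` is nonzero with sign (-1)^m. As a strict inequality it passes through products and
-- can be obtained from sums of nonnegative terms.
Signed : ℕ → ℤ → Set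
Signed m z = 0ℤ ℤ.< ε m ℤ.* z

*-positive : ∀ {x y} → 0ℤ ℤ.< x → 0ℤ ℤ.< y → 0ℤ ℤ.< x ℤ.* y
*-positive {+ suc _} {+ suc _} (+<+ _) (+<+ _) = +<+ (s≤s z≤n)

Signed-* : ∀ {l m x y} → Signed l x → Signed m y → Signed (l ℕ.+ m) (x ℤ.* y)
Signed-* {l} {m} {x} {y} sx sy = subst (0ℤ ℤ.<_)
  (trans (interchange (ε l) x (ε m) y) (cong (ℤ._* (x ℤ.* y)) (sym (ε-+ l m)))) (*-positive sx sy)
  where
  interchange : ∀ a b c d → a ℤ.* b ℤ.* (c ℤ.* d) ≡ a ℤ.* c ℤ.* (b ℤ.* d)
  interchange = solve-∀

Signed⇒sgn : ∀ m {z} → Signed m z → sgn z ≡ ε m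
Signed⇒sgn zero {z} pos = positive (subst (0ℤ ℤ.<_) (ℤₚ.*-identityˡ z) pos)
  where
  positive : ∀ {z} → 0ℤ ℤ.< z → sgn z ≡ 1ℤ
  positive {+ suc _} (+<+ _) = refl
Signed⇒sgn (suc zero) {z} pos = negative z pos
  where
  negative : ∀ z → 0ℤ ℤ.< -1ℤ ℤ.* z → sgn z ≡ -1ℤ
  negative (+ zero)      (+<+ ())
  negative (+ suc _)     ()
  negative (ℤ.-[1+ _ ]) pos = refl
Signed⇒sgn (suc (suc m)) {z} pos =
  trans (Signed⇒sgn m (subst (λ s → 0ℤ ℤ.< s ℤ.* z) (ε-suc-suc m) pos)) (sym (ε-suc-suc m))

-- Insertion, deletion and nested chains of subsets.

∪-⊆ : ∀ {S T U : Subset n} → S ⊆ U → T ⊆ U → S ∪ T ⊆ U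
∪-⊆ {S = S} {T} S⊆U T⊆U x∈ = [ S⊆U , T⊆U ]′ (x∈p∪q⁻ S T x∈)

⁅⁆⊆ : ∀ {e} {S : Subset n} → e ∈ S → ⁅ e ⁆ ⊆ S
⁅⁆⊆ {e = e} {S} e∈S x∈ = subst (_∈ S) (sym (x∈⁅y⁆⇒x≡y e x∈)) e∈S

∪-monoˡ : ∀ {S T : Subset n} U → S ⊆ T → S ∪ U ⊆ T ∪ U
∪-monoˡ {T = T} U S⊆T = ∪-⊆ (p⊆p∪q U ∘ S⊆T) (q⊆p∪q T U)

e∈insert : ∀ (S : Subset n) e → e ∈ S ∪ ⁅ e ⁆
e∈insert S e = q⊆p∪q S ⁅ e ⁆ (x∈⁅x⁆ e)

⊆-insert⁻ : ∀ {S T : Subset n} {e} → e ∉ S → S ⊆ T ∪ ⁅ e ⁆ → S ⊆ T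
⊆-insert⁻ {S = S} {T} {e} e∉S S⊆ x∈S with x∈p∪q⁻ T ⁅ e ⁆ (S⊆ x∈S)
... | inj₁ x∈T = x∈T
... | inj₂ x∈e = ⊥-elim (e∉S (subst (_∈ S) (x∈⁅y⁆⇒x≡y e x∈e) x∈S))

∉-delete : ∀ (S : Subset n) e → e ∉ S - e
∉-delete (inside  ∷ S) zero    ()
∉-delete (outside ∷ S) zero    ()
∉-delete (_ ∷ S)       (suc e) (there e∈) = ∉-delete S e e∈

⊆-delete : ∀ {S T : Subset n} {e} → S ⊆ T → e ∉ S → S ⊆ T - e
⊆-delete {S = S} S⊆T e∉S x∈S = x∈p∧x≢y⇒x∈p-y (S⊆T x∈S) λ { refl → e∉S x∈S }

delete-⊆ : ∀ (S : Subset n) e → S - e ⊆ S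
delete-⊆ S e = p─q⊆p S ⁅ e ⁆

⊆-delete-insert : ∀ (S : Subset n) e → S ⊆ (S - e) ∪ ⁅ e ⁆
⊆-delete-insert S e {x} x∈S with x ∈? ⁅ e ⁆
... | yes x∈e = q⊆p∪q (S - e) ⁅ e ⁆ x∈e
... | no x∉e  = p⊆p∪q ⁅ e ⁆ (x∈p∧x∉q⇒x∈p─q x∈S x∉e)

∣insert∣ : ∀ (S : Subset n) {e} → e ∉ S → ∣ S ∪ ⁅ e ⁆ ∣ ≡ suc ∣ S ∣
∣insert∣ (inside ∷ S)  {zero}  e∉ = ⊥-elim (e∉ here)
∣insert∣ (outside ∷ S) {zero}  e∉ = cong (suc ∘ ∣_∣) (∪-identityʳ S)
∣insert∣ (inside ∷ S)  {suc e} e∉ = cong suc (∣insert∣ S (e∉ ∘ there))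
∣insert∣ (outside ∷ S) {suc e} e∉ = ∣insert∣ S (e∉ ∘ there)

-- For L ⊆ U the number `m` bounds the size of U outside L. It is the fuel of the
-- deletion-contraction inductions, and both ways of shortening the interval use up one unit.
insert-bound : ∀ m (L U : Subset n) {e} → e ∉ L → ∣ U ∣ ≤ suc m ℕ.+ ∣ L ∣ → ∣ U ∣ ≤ m ℕ.+ ∣ L ∪ ⁅ e ⁆ ∣
insert-bound m L U e∉L = subst (∣ U ∣ ≤_) (trans (sym (ℕₚ.+-suc m _)) (cong (m ℕ.+_) (sym (∣insert∣ L e∉L))))

delete-bound : ∀ m (L U : Subset n) {e} → e ∈ U → ∣ U ∣ ≤ suc m ℕ.+ ∣ L ∣ → ∣ U - e ∣ ≤ m ℕ.+ ∣ L ∣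
delete-bound m L U e∈U bound = ℕₚ.≤-pred (ℕₚ.≤-trans (x∈p⇒∣p-x∣<∣p∣ e∈U) bound)

bound-positive : ∀ {L U : Subset n} {e} → L ⊆ U → e ∉ L → e ∈ U → ¬ ∣ U ∣ ≤ ∣ L ∣
bound-positive L⊆U e∉L e∈U = ℕₚ.<⇒≱ (p⊂q⇒∣p∣<∣q∣ (L⊆U , _ , e∈U , e∉L))

⊆-or-witness : ∀ (S T : Subset n) → S ⊆ T ⊎ ∃ λ e → e ∈ S × e ∉ T
⊆-or-witness S T with any? (λ e → (e ∈? S) ×-dec ¬? (e ∈? T))
... | yes witness = inj₂ witness
... | no none     = inj₁ λ {x} x∈S → decidable-stable (x ∈? T) λ x∉T → none (x , x∈S , x∉T)

⊥∷-linked : ∀ {Ss : Vec (Subset n) k} → Linked _⊆_ Ss → Linked _⊆_ (⊥ ∷ Ss)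
⊥∷-linked {Ss = []}     linked = [-]
⊥∷-linked {Ss = S ∷ Ss} linked = ⊥⊆ ∷ linked

linked-tail : ∀ {S} {Ss : Vec (Subset n) k} → Linked _⊆_ (S ∷ Ss) → Linked _⊆_ Ss
linked-tail [-]          = []
linked-tail (_ ∷ linked) = linked

shrink-head : ∀ {S X} {Xs : Vec (Subset n) k} → S ⊆ X → Linked _⊆_ (X ∷ Xs) → Linked _⊆_ (S ∷ Xs)
shrink-head S⊆X [-]            = [-]
shrink-head S⊆X (X⊆Y ∷ linked) = (λ x∈S → X⊆Y (S⊆X x∈S)) ∷ linked

-- Sums over Boolean intervals L ⊆ S ⊆ U.

intervalSum : Subset n → Subset n → (Subset n → ℤ) → ℤ
intervalSum {n} L U f = ∑ (subsets n) λ S → when (L ⊆? S ×-dec S ⊆? U) (f S)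

-- The sets containing `e` form the upper subinterval (contraction), those avoiding it the lower one
-- (deletion).
intervalSum-split : ∀ {L U : Subset n} {e} f → e ∉ L → e ∈ U →
  intervalSum L U f ≡ intervalSum (L ∪ ⁅ e ⁆) U f ℤ.+ intervalSum L (U - e) f
intervalSum-split {n} {L} {U} {e} f e∉L e∈U =
  trans (∑-cong (subsets n) split) (∑-+ (subsets n) _ _)
  where
  split : ∀ S → when (L ⊆? S ×-dec S ⊆? U) (f S) ≡
    when (L ∪ ⁅ e ⁆ ⊆? S ×-dec S ⊆? U) (f S) ℤ.+ when (L ⊆? S ×-dec S ⊆? U - e) (f S)
  split S with e ∈? S
  ... | yes e∈S = sym (trans (cong₂ ℤ._+_
    (when-cong (L ∪ ⁅ e ⁆ ⊆? S ×-dec S ⊆? U) (L ⊆? S ×-dec S ⊆? U)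
      (λ (L⊆S , S⊆U) → (λ x∈L → L⊆S (p⊆p∪q ⁅ e ⁆ x∈L)) , (λ {x} → S⊆U {x}))
      (λ (L⊆S , S⊆U) → ∪-⊆ L⊆S (⁅⁆⊆ e∈S) , (λ {x} → S⊆U {x})) (λ _ → refl))
    (when-zero (L ⊆? S ×-dec S ⊆? U - e) λ (_ , S⊆U-e) → ⊥-elim (∉-delete U e (S⊆U-e e∈S))))
    (ℤₚ.+-identityʳ _))
  ... | no e∉S = sym (trans (cong₂ ℤ._+_
    (when-zero (L ∪ ⁅ e ⁆ ⊆? S ×-dec S ⊆? U) λ (L⊆S , _) → ⊥-elim (e∉S (L⊆S (e∈insert L e))))
    (when-cong (L ⊆? S ×-dec S ⊆? U - e) (L ⊆? S ×-dec S ⊆? U)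
      (λ (L⊆S , S⊆U) → (λ {x} → L⊆S {x}) , (λ x∈S → delete-⊆ U e (S⊆U x∈S)))
      (λ (L⊆S , S⊆U) → (λ {x} → L⊆S {x}) , ⊆-delete S⊆U e∉S) (λ _ → refl)))
    (ℤₚ.+-identityˡ _))

intervalSum-refl : ∀ (L : Subset n) f → intervalSum L L f ≡ f L
intervalSum-refl L f = trans
  (∑-single L _ λ S S≢L → when-zero (L ⊆? S ×-dec S ⊆? L) λ (L⊆S , S⊆L) → ⊥-elim (S≢L (⊆-antisym S⊆L L⊆S)))
  (when-yes (L ⊆? L ×-dec L ⊆? L) (⊆-refl , ⊆-refl))

intervalSum-cancel : ∀ {L U : Subset n} {e} f → e ∉ L → e ∈ U →
  (∀ S → L ⊆ S → e ∉ S → f S ℤ.+ f (S ∪ ⁅ e ⁆) ≡ 0ℤ) → intervalSum L U f ≡ 0ℤ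
intervalSum-cancel {n} {L} {U} {e} f e∉L e∈U opposite = ∑-cancel e _ cancel
  where
  cancel : ∀ S → e ∉ S →
    when (L ⊆? S ×-dec S ⊆? U) (f S) ℤ.+ when (L ⊆? S ∪ ⁅ e ⁆ ×-dec S ∪ ⁅ e ⁆ ⊆? U) (f (S ∪ ⁅ e ⁆)) ≡ 0ℤ
  cancel S e∉S = trans
    (cong (ℤ._+_ (when (L ⊆? S ×-dec S ⊆? U) (f S)))
      (when-cong (L ⊆? S ∪ ⁅ e ⁆ ×-dec S ∪ ⁅ e ⁆ ⊆? U) (L ⊆? S ×-dec S ⊆? U)
        (λ (L⊆ , ⊆U) → ⊆-insert⁻ e∉L L⊆ , (λ x∈S → ⊆U (p⊆p∪q ⁅ e ⁆ x∈S)))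
        (λ (L⊆S , S⊆U) → (λ x∈L → p⊆p∪q ⁅ e ⁆ (L⊆S x∈L)) , ∪-⊆ S⊆U (⁅⁆⊆ e∈U))
        (λ _ → refl)))
    (when-cancel (L ⊆? S ×-dec S ⊆? U) λ (L⊆S , _) → opposite S L⊆S e∉S)

-- Rank, spanned elements and closures.

module _ {n : ℕ} (M : Matroid n) where
  open Matroid M using (rk-bounded; rk-monotone; rk-submodular)

  insert-≤ : ∀ S e → rk M (S ∪ ⁅ e ⁆) ≤ suc (rk M S)
  insert-≤ S e = begin
    rk M (S ∪ ⁅ e ⁆)                          ≤⟨ ℕₚ.m≤m+n _ _ ⟩
    rk M (S ∪ ⁅ e ⁆) ℕ.+ rk M (S ∩ ⁅ e ⁆)     ≤⟨ rk-submodular S ⁅ e ⁆ ⟩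
    rk M S ℕ.+ rk M ⁅ e ⁆                     ≤⟨ ℕₚ.+-monoʳ-≤ (rk M S) (rk-bounded ⁅ e ⁆) ⟩
    rk M S ℕ.+ ∣ ⁅ e ⁆ ∣                      ≡⟨ cong (rk M S ℕ.+_) (∣⁅x⁆∣≡1 e) ⟩
    rk M S ℕ.+ 1                              ≡⟨ ℕₚ.+-comm (rk M S) 1 ⟩
    suc (rk M S)                              ∎
    where open ℕₚ.≤-Reasoning

  -- Submodularity for T and S ∪ {e}: their union contains T ∪ {e} and their intersection contains
  -- S, so rk S can be cancelled.
  spanned-mono : ∀ {S T e} → S ⊆ T → rk M (S ∪ ⁅ e ⁆) ≤ rk M S → rk M (T ∪ ⁅ e ⁆) ≤ rk M T
  spanned-mono {S} {T} {e} S⊆T spanned = ℕₚ.+-cancelʳ-≤ (rk M S) _ _ (begin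
    rk M (T ∪ ⁅ e ⁆) ℕ.+ rk M S
      ≤⟨ ℕₚ.+-mono-≤ (rk-monotone _ _ (∪-⊆ (p⊆p∪q _) (λ x∈e → q⊆p∪q T _ (q⊆p∪q S _ x∈e))))
                     (rk-monotone _ _ (λ x∈S → x∈p∩q⁺ (S⊆T x∈S , p⊆p∪q ⁅ e ⁆ x∈S))) ⟩
    rk M (T ∪ (S ∪ ⁅ e ⁆)) ℕ.+ rk M (T ∩ (S ∪ ⁅ e ⁆))
      ≤⟨ rk-submodular T (S ∪ ⁅ e ⁆) ⟩
    rk M T ℕ.+ rk M (S ∪ ⁅ e ⁆)
      ≤⟨ ℕₚ.+-monoʳ-≤ (rk M T) spanned ⟩
    rk M T ℕ.+ rk M S ∎)
    where open ℕₚ.≤-Reasoning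

  flat-absorbs : ∀ {S F e} → Flat M F → S ⊆ F → rk M (S ∪ ⁅ e ⁆) ≤ rk M S → e ∈ F
  flat-absorbs {S} {F} {e} flatF S⊆F spanned = decidable-stable (e ∈? F) λ e∉F →
    ℕₚ.<⇒≱ (flatF e e∉F) (spanned-mono S⊆F spanned)

  ¬flat⇒spanned : ∀ S → ¬ Flat M S → ∃ λ e → e ∉ S × rk M (S ∪ ⁅ e ⁆) ≤ rk M S
  ¬flat⇒spanned S ¬flat with any? (λ e → ¬? (e ∈? S) ×-dec (rk M (S ∪ ⁅ e ⁆) ℕ.≤? rk M S))
  ... | yes witness = witness
  ... | no none     = ⊥-elim (¬flat λ e e∉S → ℕₚ.≰⇒> λ spanned → none (e , e∉S , spanned))

  -- Spanned elements are added until none is left, which never raises the rank. The fuel `m` bounds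
  -- how many elements are still missing from the set.
  spanningFlat : ∀ S → ∃ λ F → Flat M F × S ⊆ F × rk M F ≤ rk M S
  spanningFlat S = go n S (ℕₚ.m≤m+n n _)
    where
    go : ∀ m S → n ≤ m ℕ.+ ∣ S ∣ → ∃ λ F → Flat M F × S ⊆ F × rk M F ≤ rk M S
    go m S bound with flat? M S
    ... | yes flatS = S , flatS , (λ x∈S → x∈S) , ℕₚ.≤-refl
    ... | no ¬flat with ¬flat⇒spanned S ¬flat
    go zero S bound | no ¬flat | e , e∉S , _ =
      ⊥-elim (ℕₚ.<⇒≱ (subst (_≤ n) (∣insert∣ S e∉S) (∣p∣≤n (S ∪ ⁅ e ⁆))) bound)
    go (suc m) S bound | no ¬flat | e , e∉S , spanned
      with go m (S ∪ ⁅ e ⁆) (subst (n ≤_) (trans (sym (ℕₚ.+-suc m _)) (cong (m ℕ.+_) (sym (∣insert∣ S e∉S)))) bound)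
    ... | F , flatF , S∪e⊆F , rkF≤ =
      F , flatF , (λ x∈S → S∪e⊆F (p⊆p∪q ⁅ e ⁆ x∈S)) , ℕₚ.≤-trans rkF≤ spanned

  closure-rk : ∀ {S X} → IsClosure M S X → rk M S ≡ rk M X
  closure-rk {S} {X} cl with spanningFlat S
  ... | F , flatF , S⊆F , rkF≤rkS = ℕₚ.≤-antisym (rk-monotone S X contains)
    (ℕₚ.≤-trans (rk-monotone X F (smallest F flatF S⊆F)) rkF≤rkS)
    where open IsClosure cl

  -- Each element of X is spanned by S, since adding it stays below rk X = rk S; hence it lies in
  -- every flat containing S. With `closure-rk` this turns closure in a flat X into containment plus
  -- equality of ranks.
  closure-intro : ∀ {S X} → Flat M X → S ⊆ X → rk M S ≡ rk M X → IsClosure M S X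
  closure-intro {S} {X} flatX S⊆X rkS≡rkX = record
    { flat     = flatX
    ; contains = S⊆X
    ; smallest = λ G flatG S⊆G {e} e∈X → flat-absorbs flatG S⊆G
        (subst (rk M (S ∪ ⁅ e ⁆) ≤_) (sym rkS≡rkX) (rk-monotone _ X (∪-⊆ S⊆X (⁅⁆⊆ e∈X))))
    }

  -- Signs of interval sums by deletion-contraction.

  -- For S inside a flat X of rank `r`, the guard says that S has closure X. A condition on rank
  -- alone still makes sense after deletion, when the upper end of the interval need not be flat.
  weight : ℕ → Subset n → ℤ
  weight r S = when (rk M S ≟ r) (ε ∣ S ∣)

  weight-cancel : ∀ r {S e} → e ∉ S → rk M (S ∪ ⁅ e ⁆) ≤ rk M S → weight r S ℤ.+ weight r (S ∪ ⁅ e ⁆) ≡ 0ℤ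
  weight-cancel r {S} {e} e∉S spanned
    rewrite ℕₚ.≤-antisym spanned (rk-monotone S _ (p⊆p∪q ⁅ e ⁆)) | ∣insert∣ S e∉S
    = when-cancel (rk M S ≟ r) λ _ → ε-suc-cancel ∣ S ∣

  -- An element spanned by L is spanned by every S above L, so toggling it keeps the rank and flips
  -- the sign.
  spanned-vanish : ∀ r {L U e} → e ∉ L → e ∈ U → rk M (L ∪ ⁅ e ⁆) ≤ rk M L → intervalSum L U (weight r) ≡ 0ℤ
  spanned-vanish r e∉L e∈U spanned = intervalSum-cancel (weight r) e∉L e∈U
    λ S L⊆S e∉S → weight-cancel r e∉S (spanned-mono L⊆S spanned)

  -- The interval sum multiplied by its expected sign. For flats L ⊆ U and r = rk U it is the
  -- absolute value of the Möbius function of the lattice of flats at (L, U).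
  signedSum : ℕ → Subset n → Subset n → ℤ
  signedSum r L U = ε (∣ L ∣ ℕ.+ rk M L ℕ.+ r) ℤ.* intervalSum L U (weight r)

  signedSum-refl : ∀ {r} L → rk M L ≡ r → signedSum r L L ≡ 1ℤ
  signedSum-refl {r} L refl = begin
    ε (c ℕ.+ r ℕ.+ r) ℤ.* intervalSum L L (weight r)
      ≡⟨ cong (ε (c ℕ.+ r ℕ.+ r) ℤ.*_) (trans (intervalSum-refl L (weight r)) (when-yes (r ≟ r) refl)) ⟩
    ε (c ℕ.+ r ℕ.+ r) ℤ.* ε c
      ≡⟨ cong (ℤ._* ε c) (trans (ε-+ (c ℕ.+ r) r) (cong (ℤ._* ε r) (ε-+ c r))) ⟩
    ε c ℤ.* ε r ℤ.* ε r ℤ.* ε c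
      ≡⟨ regroup (ε c) (ε r) ⟩
    ε c ℤ.* ε c ℤ.* (ε r ℤ.* ε r)
      ≡⟨ cong₂ ℤ._*_ (ε-square c) (ε-square r) ⟩
    1ℤ ∎
    where
    open ≡-Reasoning
    c = ∣ L ∣
    regroup : ∀ a b → a ℤ.* b ℤ.* b ℤ.* a ≡ a ℤ.* a ℤ.* (b ℤ.* b)
    regroup = solve-∀

  -- Inserting an unspanned `e` raises both the size and the rank of L by one, so the normalising
  -- sign is the same on both parts.
  signedSum-split : ∀ r {L U e} → e ∉ L → e ∈ U → rk M L < rk M (L ∪ ⁅ e ⁆) →
    signedSum r L U ≡ signedSum r (L ∪ ⁅ e ⁆) U ℤ.+ signedSum r L (U - e)
  signedSum-split r {L} {U} {e} e∉L e∈U indep = trans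
    (cong (s ℤ.*_) (intervalSum-split (weight r) e∉L e∈U))
    (trans (ℤₚ.*-distribˡ-+ s _ _)
      (cong (λ z → z ℤ.* intervalSum (L ∪ ⁅ e ⁆) U (weight r) ℤ.+ signedSum r L (U - e)) (sym sameSign)))
    where
    s = ε (∣ L ∣ ℕ.+ rk M L ℕ.+ r)
    sameSign : ε (∣ L ∪ ⁅ e ⁆ ∣ ℕ.+ rk M (L ∪ ⁅ e ⁆) ℕ.+ r) ≡ s
    sameSign
      rewrite ∣insert∣ L e∉L | ℕₚ.≤-antisym (insert-≤ L e) indep | ℕₚ.+-suc ∣ L ∣ (rk M L)
      = ε-suc-suc (∣ L ∣ ℕ.+ rk M L ℕ.+ r)

  -- Controls the part that may vanish in a split. The rank `r` is arbitrary because deleting a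
  -- coloop leaves an interval whose top has rank below `r`.
  signedSum-nonneg : ∀ m r {L U} → ∣ U ∣ ≤ m ℕ.+ ∣ L ∣ → L ⊆ U → 0ℤ ℤ.≤ signedSum r L U
  signedSum-nonneg m r {L} {U} bound L⊆U with ⊆-or-witness U L
  signedSum-nonneg m r {L} {U} bound L⊆U | inj₁ U⊆L with ⊆-antisym U⊆L L⊆U | rk M L ≟ r
  ... | refl | yes rkL≡r = subst (0ℤ ℤ.≤_) (sym (signedSum-refl L rkL≡r)) (+≤+ z≤n)
  ... | refl | no rkL≢r  = ℤₚ.≤-reflexive (sym (trans
    (cong (ε (∣ L ∣ ℕ.+ rk M L ℕ.+ r) ℤ.*_)
      (trans (intervalSum-refl L (weight r)) (when-zero (rk M L ≟ r) (⊥-elim ∘ rkL≢r))))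
    (ℤₚ.*-zeroʳ (ε (∣ L ∣ ℕ.+ rk M L ℕ.+ r)))))
  signedSum-nonneg zero r bound L⊆U | inj₂ (e , e∈U , e∉L) = ⊥-elim (bound-positive L⊆U e∉L e∈U bound)
  signedSum-nonneg (suc m) r {L} {U} bound L⊆U | inj₂ (e , e∈U , e∉L) with rk M L <? rk M (L ∪ ⁅ e ⁆)
  ... | yes indep = subst (0ℤ ℤ.≤_) (sym (signedSum-split r e∉L e∈U indep)) (ℤₚ.+-mono-≤
    (signedSum-nonneg m r (insert-bound m L U e∉L bound) (∪-⊆ L⊆U (⁅⁆⊆ e∈U)))
    (signedSum-nonneg m r (delete-bound m L U e∈U bound) (⊆-delete L⊆U e∉L)))
  ... | no dep = ℤₚ.≤-reflexive (sym (trans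
    (cong (ε (∣ L ∣ ℕ.+ rk M L ℕ.+ r) ℤ.*_) (spanned-vanish r e∉L e∈U (ℕₚ.≮⇒≥ dep)))
    (ℤₚ.*-zeroʳ (ε (∣ L ∣ ℕ.+ rk M L ℕ.+ r)))))

  -- For L ⊆ U: L is a flat of the restriction of M to U.
  FlatIn : Subset n → Subset n → Set
  FlatIn U L = ∀ e → e ∈ U → e ∉ L → rk M L < rk M (L ∪ ⁅ e ⁆)

  -- If L ∪ {e} spanned a further `f`, then by exchange L ∪ {f} would span `e`. Since L ∪ {f} avoids
  -- `e`, so would U - e, contradicting that `e` is a coloop of U.
  coloop-flatIn : ∀ {L U e} → L ⊆ U → e ∉ L → e ∈ U → rk M (U - e) < rk M U → FlatIn U L → FlatIn U (L ∪ ⁅ e ⁆)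
  coloop-flatIn {L} {U} {e} L⊆U e∉L e∈U coloop flat f f∈U f∉L∪e = ℕₚ.≰⇒> λ dep →
    ℕₚ.<⇒≱ coloop (ℕₚ.≤-trans (rk-monotone U _ (⊆-delete-insert U e))
      (spanned-mono L∪f⊆U-e (begin
        rk M ((L ∪ ⁅ f ⁆) ∪ ⁅ e ⁆) ≤⟨ rk-monotone _ _ (∪-⊆ (∪-monoˡ ⁅ f ⁆ (p⊆p∪q ⁅ e ⁆)) (λ x∈e → p⊆p∪q ⁅ f ⁆ (q⊆p∪q L ⁅ e ⁆ x∈e))) ⟩
        rk M ((L ∪ ⁅ e ⁆) ∪ ⁅ f ⁆) ≤⟨ dep ⟩
        rk M (L ∪ ⁅ e ⁆)           ≤⟨ insert-≤ L e ⟩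
        suc (rk M L)               ≤⟨ flat f f∈U (λ f∈L → f∉L∪e (p⊆p∪q ⁅ e ⁆ f∈L)) ⟩
        rk M (L ∪ ⁅ f ⁆)           ∎)))
    where
    open ℕₚ.≤-Reasoning
    L∪f⊆U-e : L ∪ ⁅ f ⁆ ⊆ U - e
    L∪f⊆U-e = ∪-⊆ (⊆-delete L⊆U e∉L)
      (⁅⁆⊆ (x∈p∧x≢y⇒x∈p-y f∈U λ { refl → f∉L∪e (e∈insert L f) }))

  signedSum-pos : ∀ m {L U} → ∣ U ∣ ≤ m ℕ.+ ∣ L ∣ → L ⊆ U → FlatIn U L → 0ℤ ℤ.< signedSum (rk M U) L U
  signedSum-pos m {L} {U} bound L⊆U flat with ⊆-or-witness U L
  signedSum-pos m {L} {U} bound L⊆U flat | inj₁ U⊆L with ⊆-antisym U⊆L L⊆U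
  ... | refl = subst (0ℤ ℤ.<_) (sym (signedSum-refl L refl)) (+<+ (s≤s z≤n))
  signedSum-pos zero bound L⊆U flat | inj₂ (e , e∈U , e∉L) = ⊥-elim (bound-positive L⊆U e∉L e∈U bound)
  signedSum-pos (suc m) {L} {U} bound L⊆U flat | inj₂ (e , e∈U , e∉L) =
    subst (0ℤ ℤ.<_) (sym (signedSum-split (rk M U) e∉L e∈U (flat e e∈U e∉L))) positive
    where
    L∪e⊆U : L ∪ ⁅ e ⁆ ⊆ U
    L∪e⊆U = ∪-⊆ L⊆U (⁅⁆⊆ e∈U)
    L⊆U-e : L ⊆ U - e
    L⊆U-e = ⊆-delete L⊆U e∉L
    positive : 0ℤ ℤ.< signedSum (rk M U) (L ∪ ⁅ e ⁆) U ℤ.+ signedSum (rk M U) L (U - e)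
    positive with rk M (U - e) <? rk M U
    ... | yes coloop = ℤₚ.+-mono-<-≤
      (signedSum-pos m (insert-bound m L U e∉L bound) L∪e⊆U (coloop-flatIn L⊆U e∉L e∈U coloop flat))
      (signedSum-nonneg m (rk M U) (delete-bound m L U e∈U bound) L⊆U-e)
    -- Deleting a non-coloop keeps the rank of U, so the target rank is still that of the top, and L
    -- stays flat in the smaller set.
    ... | no ¬coloop = ℤₚ.+-mono-≤-<
      (signedSum-nonneg m (rk M U) (insert-bound m L U e∉L bound) L∪e⊆U)
      (subst (λ r → 0ℤ ℤ.< signedSum r L (U - e))
        (ℕₚ.≤-antisym (rk-monotone _ U (delete-⊆ U e)) (ℕₚ.≮⇒≥ ¬coloop))
        (signedSum-pos m (delete-bound m L U e∈U bound) L⊆U-e λ f f∈U-e → flat f (delete-⊆ U e f∈U-e)))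

  -- The chain Möbius function as an iterated sum.

  -- `L` stands for the preceding set of the chain, the only trace that the earlier sets leave on
  -- the sum over the tail.
  chainSum : Subset n → Vec (Subset n) k → ℤ
  chainSum L []       = 1ℤ
  chainSum L (X ∷ Xs) = ∑ (subsets n) λ S →
    when (L ⊆? S ×-dec isClosure? M S X) (ε ∣ S ∣ ℤ.* chainSum S Xs)

  chainSum-expand : ∀ L (Xs : Vec (Subset n) k) →
    ∑ (tuples (subsets n) k) (λ Ss → when (linked? _⊆?_ (L ∷ Ss) ×-dec Pointwise.decidable (isClosure? M) Ss Xs)
      (∏[ (λ S → ε ∣ S ∣) ] Ss)) ≡ chainSum L Xs
  chainSum-expand L []                 = refl
  chainSum-expand {k = suc k} L (X ∷ Xs) = trans (∑-tuples-suc (subsets n) k _) (∑-cong (subsets n) λ S →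
    trans (∑-cong (tuples (subsets n) k) (λ Ss → when-nested
        (linked? _⊆?_ (L ∷ S ∷ Ss) ×-dec Pointwise.decidable (isClosure? M) (S ∷ Ss) (X ∷ Xs))
        (L ⊆? S ×-dec isClosure? M S X)
        (linked? _⊆?_ (S ∷ Ss) ×-dec Pointwise.decidable (isClosure? M) Ss Xs)
        (λ { (L⊆S ∷ linked , cl ∷ cls) → ((λ {x} → L⊆S {x}) , cl) , (linked , cls) })
        (λ { (L⊆S , cl) (linked , cls) → (λ {x} → L⊆S {x}) ∷ linked , cl ∷ cls })
        (ε ∣ S ∣) (∏[ (λ S → ε ∣ S ∣) ] Ss)))
    (trans (∑-when (L ⊆? S ×-dec isClosure? M S X) (tuples (subsets n) k) _)
    (cong (when (L ⊆? S ×-dec isClosure? M S X))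
      (trans (∑-*ˡ (tuples (subsets n) k) (ε ∣ S ∣) _)
        (cong (ε ∣ S ∣ ℤ.*_) (chainSum-expand S Xs))))))

  -- Prefixing the empty set puts no condition on a chain, so the first set can be treated like all
  -- later ones.
  μ≡chainSum : (X : FlatChain M k) → μ M X ≡ chainSum ⊥ (flats X)
  μ≡chainSum {k = k} X = trans (∑-filter closes? (chains n k) _)
    (trans (∑-filter (linked? _⊆?_) (tuples (subsets n) k) _)
    (trans (∑-cong (tuples (subsets n) k) λ Ss →
      merge (linked? _⊆?_ Ss) (closes? Ss) (linked? _⊆?_ (⊥ ∷ Ss) ×-dec closes? Ss)
        (λ linked cls → ⊥∷-linked linked , cls) (λ (linked , cls) → linked-tail linked , cls))
    (chainSum-expand ⊥ (flats X))))
    where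
    closes? : Decidable (λ Ss → Pointwise (IsClosure M) Ss (flats X))
    closes? Ss = Pointwise.decidable (isClosure? M) Ss (flats X)
    merge : ∀ {P Q R : Set} (p? : Dec P) (q? : Dec Q) (r? : Dec R) → (P → Q → R) → (R → P × Q) → ∀ {x} →
      when p? (when q? x) ≡ when r? x
    merge (yes p) q? r? to from = when-cong q? r? (to p) (proj₂ ∘ from) λ _ → refl
    merge (no ¬p) q? r? to from = sym (when-zero r? λ r → ⊥-elim (¬p (proj₁ (from r))))

  -- Alternation between constant and flat-supported tails.

  totalRank : Vec (Subset n) k → ℕ
  totalRank Xs = Vec.sum (Vec.map (rk M) Xs)

  ε-totalRank : ∀ (Xs : Vec (Subset n) k) → ε (totalRank Xs) ≡ ∏[ (λ F → -1ℤ ^ rk M F) ] Xs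
  ε-totalRank []       = refl
  ε-totalRank (X ∷ Xs) = trans (ε-+ (rk M X) (totalRank Xs)) (cong (ε (rk M X) ℤ.*_) (ε-totalRank Xs))

  Constant : Vec (Subset n) k → Set
  Constant Xs = ∃ λ c → Signed (totalRank Xs) c × (∀ L → Linked _⊆_ (L ∷ Xs) → chainSum L Xs ≡ c)

  -- The term |L| in the exponent is there to cancel against the factor (-1)^|L| that L itself
  -- contributes one level up.
  FlatSupported : Vec (Subset n) k → Set
  FlatSupported Xs = ∀ L → Linked _⊆_ (L ∷ Xs) →
    (¬ Flat M L → chainSum L Xs ≡ 0ℤ) ×
    (Flat M L → Signed (∣ L ∣ ℕ.+ rk M L ℕ.+ totalRank Xs) (chainSum L Xs))

  -- The constant `c` comes out of the sum, leaving a weighted sum over the interval from L to X. If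
  -- L is not flat, an element it spans lies in the flat X and makes that sum vanish.
  constant⇒flatSupported : ∀ {X} {Xs : Vec (Subset n) k} → Flat M X → Constant Xs → FlatSupported (X ∷ Xs)
  constant⇒flatSupported {X = X} {Xs} flatX (c , signed-c , const) L (L⊆X ∷ linked) = vanish , signed
    where
    factor : chainSum L (X ∷ Xs) ≡ c ℤ.* intervalSum L X (weight (rk M X))
    factor = trans (∑-cong (subsets n) pointwise) (∑-*ˡ (subsets n) c _)
      where
      pointwise : ∀ S → when (L ⊆? S ×-dec isClosure? M S X) (ε ∣ S ∣ ℤ.* chainSum S Xs) ≡
        c ℤ.* when (L ⊆? S ×-dec S ⊆? X) (weight (rk M X) S)
      pointwise S = begin
        when (L ⊆? S ×-dec isClosure? M S X) (ε ∣ S ∣ ℤ.* chainSum S Xs)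
          -- The guard itself gives S ⊆ X, so S followed by `Xs` is nested and the tail sum equals
          -- `c`.
          ≡⟨ when-cong (L ⊆? S ×-dec isClosure? M S X) (L ⊆? S ×-dec isClosure? M S X) (λ p → p) (λ p → p)
               (λ (_ , cl) → trans (ℤₚ.*-comm (ε ∣ S ∣) _)
                 (cong (ℤ._* ε ∣ S ∣) (const S (shrink-head (IsClosure.contains cl) linked)))) ⟩
        when (L ⊆? S ×-dec isClosure? M S X) (c ℤ.* ε ∣ S ∣)
          ≡⟨ when-nested (L ⊆? S ×-dec isClosure? M S X) (L ⊆? S ×-dec S ⊆? X) (rk M S ≟ rk M X)
               (λ (L⊆S , cl) → ((λ {x} → L⊆S {x}) , (λ {x} → IsClosure.contains cl {x})) , closure-rk cl)
               (λ (L⊆S , S⊆X) rk≡ → (λ {x} → L⊆S {x}) , closure-intro flatX S⊆X rk≡)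
               c (ε ∣ S ∣) ⟩
        when (L ⊆? S ×-dec S ⊆? X) (c ℤ.* weight (rk M X) S)
          ≡⟨ *-when (L ⊆? S ×-dec S ⊆? X) c _ ⟨
        c ℤ.* when (L ⊆? S ×-dec S ⊆? X) (weight (rk M X) S) ∎
        where open ≡-Reasoning

    vanish : ¬ Flat M L → chainSum L (X ∷ Xs) ≡ 0ℤ
    vanish ¬flat with ¬flat⇒spanned L ¬flat
    ... | e , e∉L , spanned = trans factor (trans
      (cong (c ℤ.*_) (spanned-vanish (rk M X) e∉L (flat-absorbs flatX L⊆X spanned) spanned)) (ℤₚ.*-zeroʳ c))

    signed : Flat M L → Signed (∣ L ∣ ℕ.+ rk M L ℕ.+ (rk M X ℕ.+ totalRank Xs)) (chainSum L (X ∷ Xs))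
    signed flatL = subst (λ m → Signed m (chainSum L (X ∷ Xs))) (ℕₚ.+-assoc (∣ L ∣ ℕ.+ rk M L) (rk M X) (totalRank Xs))
      (subst (Signed (∣ L ∣ ℕ.+ rk M L ℕ.+ rk M X ℕ.+ totalRank Xs)) (trans (ℤₚ.*-comm _ c) (sym factor))
        (Signed-* {l = ∣ L ∣ ℕ.+ rk M L ℕ.+ rk M X} {m = totalRank Xs}
          -- `∣ X ∣` is a crude but sufficient amount of fuel.
          (signedSum-pos ∣ X ∣ (ℕₚ.m≤m+n _ _) L⊆X λ e _ → flatL e) signed-c))

  -- Only S = X survives: other sets with closure X are not flat, so their tail sums vanish. The
  -- remaining term does not involve L.
  flatSupported⇒constant : ∀ {X} {Xs : Vec (Subset n) k} → Flat M X → Linked _⊆_ (X ∷ Xs) →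
    FlatSupported Xs → Constant (X ∷ Xs)
  flatSupported⇒constant {X = X} {Xs} flatX linked supported =
    ε ∣ X ∣ ℤ.* chainSum X Xs , signed , collapse
    where
    signed : Signed (rk M X ℕ.+ totalRank Xs) (ε ∣ X ∣ ℤ.* chainSum X Xs)
    signed = subst (0ℤ ℤ.<_) (begin
      ε (∣ X ∣ ℕ.+ rk M X ℕ.+ totalRank Xs) ℤ.* chainSum X Xs
        ≡⟨ cong (λ m → ε m ℤ.* chainSum X Xs) (trans (ℕₚ.+-assoc ∣ X ∣ _ _) (ℕₚ.+-comm ∣ X ∣ _)) ⟩
      ε (rk M X ℕ.+ totalRank Xs ℕ.+ ∣ X ∣) ℤ.* chainSum X Xs
        ≡⟨ cong (ℤ._* chainSum X Xs) (ε-+ (rk M X ℕ.+ totalRank Xs) ∣ X ∣) ⟩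
      ε (rk M X ℕ.+ totalRank Xs) ℤ.* ε ∣ X ∣ ℤ.* chainSum X Xs
        ≡⟨ ℤₚ.*-assoc (ε (rk M X ℕ.+ totalRank Xs)) _ _ ⟩
      ε (rk M X ℕ.+ totalRank Xs) ℤ.* (ε ∣ X ∣ ℤ.* chainSum X Xs) ∎)
      (proj₂ (supported X linked) flatX)
      where open ≡-Reasoning

    collapse : ∀ L → Linked _⊆_ (L ∷ X ∷ Xs) → chainSum L (X ∷ Xs) ≡ ε ∣ X ∣ ℤ.* chainSum X Xs
    collapse L (L⊆X ∷ _) = trans (∑-single X _ others)
      (when-yes (L ⊆? X ×-dec isClosure? M X X)
        ((λ {x} → L⊆X {x}) , closure-intro flatX (λ x∈X → x∈X) refl))
      where
      others : ∀ S → S ≢ X → when (L ⊆? S ×-dec isClosure? M S X) (ε ∣ S ∣ ℤ.* chainSum S Xs) ≡ 0ℤ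
      others S S≢X = when-zero (L ⊆? S ×-dec isClosure? M S X) λ (_ , cl) →
        trans (cong (ε ∣ S ∣ ℤ.*_) (proj₁ (supported S (shrink-head (IsClosure.contains cl) linked))
          λ flatS → S≢X (⊆-antisym (IsClosure.contains cl) (IsClosure.smallest cl S flatS λ x∈S → x∈S))))
        (ℤₚ.*-zeroʳ (ε ∣ S ∣))

  alternation : ∀ {Xs : Vec (Subset n) k} → All (Flat M) Xs → Linked _⊆_ Xs → Constant Xs ⊎ FlatSupported Xs
  alternation []                []     = inj₁ (1ℤ , +<+ (s≤s z≤n) , λ L _ → refl)
  alternation (flatX ∷ areFlat) linked with alternation areFlat (linked-tail linked)
  ... | inj₁ constant  = inj₂ (constant⇒flatSupported flatX constant)
  ... | inj₂ supported = inj₁ (flatSupported⇒constant flatX linked supported)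

  -- The empty set as starting point.

  rk-⊥ : rk M ⊥ ≡ 0
  rk-⊥ = ℕₚ.n≤0⇒n≡0 (subst (rk M ⊥ ≤_) (∣⊥∣≡0 n) (rk-bounded ⊥))

  -- This is where simplicity enters: for a flat-supported chain, the sum starting from the empty
  -- set is nonzero because that set is flat.
  loopless⇒⊥-flat : (∀ e → ¬ Loop M e) → Flat M ⊥
  loopless⇒⊥-flat loopless e _ rewrite ∪-identityˡ ⁅ e ⁆ | rk-⊥ = ℕₚ.n≢0⇒n>0 (loopless e)

theorem2p8 : ∀ {n : ℕ} (M : Matroid n) → Simple M → (k : ℕ) → 1 ≤ k →
    (X : FlatChain M k) →
    sgn (μ M X) ≡ ∏[ (λ F → -1ℤ ^ rk M F) ] (flats X)
theorem2p8 {n} M (loopless , _) k _ X = trans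
  (Signed⇒sgn (totalRank M (flats X)) (subst (Signed (totalRank M (flats X))) (sym (μ≡chainSum M X)) signed))
  (ε-totalRank M (flats X))
  where
  signed : Signed (totalRank M (flats X)) (chainSum M ⊥ (flats X))
  signed with alternation M (FlatChain.areFlat X) (FlatChain.nested X)
  ... | inj₁ (c , signed-c , const) = subst (Signed (totalRank M (flats X))) (sym (const ⊥ (⊥∷-linked (FlatChain.nested X)))) signed-c
  -- Size and rank of the empty set are both 0, so the exponent reduces to the total rank.
  ... | inj₂ supported = subst (λ m → Signed (m ℕ.+ totalRank M (flats X)) (chainSum M ⊥ (flats X)))
    (cong₂ ℕ._+_ (∣⊥∣≡0 n) (rk-⊥ M))
    (proj₂ (supported ⊥ (⊥∷-linked (FlatChain.nested X))) (loopless⇒⊥-flat M loopless))
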